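{- Let $\mathcal{F}$ be the set of finite subsets of $\mathbb{Q}_{>0}$, and let $\rho:\mathbb{Q}_{<0}\to\mathcal{F}$ be a map such that for every $F\in\mathcal{F}$ the fiber $\rho^{ -1}(F)$ is dense and codense in $\mathbb{Q}_{<0}$. Let $A\subseteq\mathbb{Q}^2$ be the binary relation defined by $A(x,y)\iff x<0<y$ and $y\in\rho(x)$. Then the open core of the structure $(\mathbb{Q},<,0,A)$ is o-minimal.
   Context: "Definable" always means definable with parameters. For a structure $\mathcal{R}=(R,<,\ldots)$ expanding a dense linear order without endpoints, give $R$ the order topology and $R^n$ the product topology. The open core $\mathcal{R}^{\circ}$ of $\mathcal{R}$ is the structure with universe $R$ whose language consists of a relation symbol for each open set $U\subseteq R^n$, for every $n$, that is definable (with parameters) in $\mathcal{R}$. A structure is o-minimal if every subset of its universe definable with parameters is a finite union of points and intervals (with endpoints in the universe or $\pm\infty$). A set $D\subseteq\mathbb{Q}_{<0}$ is codense in $\mathbb{Q}_{<0}$ if $\mathbb{Q}_{<0}\setminus D$ is dense in $\mathbb{Q}_{<0}$. -}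

module Defs where

open import Data.Empty using (⊥)
open import Data.Fin.Base using (Fin)
open import Data.List.Base using (List)
open import Data.List.Membership.Propositional using (_∈_)
open import Data.List.Relation.Binary.BagAndSetEquality using (_∼[_]_; set)
import Data.List.Relation.Unary.Any as ListAny
open import Data.Nat.Base using (ℕ; suc; _+_)
open import Data.Product.Base using (Σ-syntax; ∃-syntax; _×_; _,_; proj₁)
open import Data.Rational.Base as ℚ using (ℚ; 0ℚ)
open import Data.Sum.Base using (_⊎_)
open import Data.Vec.Base as Vec using (Vec; []; _∷_; _++_; lookup)
open import Data.Vec.Relation.Binary.Pointwise.Inductive using (Pointwise)
open import Function.Base using (_∘_; _on_)
open import Function.Bundles using (_⇔_)
open import Level using (Level; 0ℓ; _⊔_) renaming (suc to lsuc)
open import Relation.Binary.Core using (Rel)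
open import Relation.Binary.PropositionalEquality.Core using (_≡_)
import Relation.Binary.Construct.Add.Extrema.Strict as AddExtrema
open import Relation.Nullary.Construct.Add.Extrema using (_±; [_])
open import Relation.Nullary.Negation.Core using (¬_)
open import Relation.Unary using (Pred; ∁; _⊆_; Satisfiable)

------------------------------------------------------------------------
-- First-order logic

record Language (f r : Level) : Set (lsuc (f ⊔ r)) where
  field
    FunSym : ℕ → Set f
    RelSym : ℕ → Set r

module _ {f r : Level} (L : Language f r) where
  open Language L

  data Term (n : ℕ) : Set f where
    var : Fin n → Term n
    app : ∀ {k} → FunSym k → Vec (Term n) k → Term n

  -- Variables are de Bruijn indices: a quantifier binds index zero.
  data Formula (n : ℕ) : Set (f ⊔ r) where
    ⊥ᶠ             : Formula n
    _≐_            : Term n → Term n → Formula n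
    rel            : ∀ {k} → RelSym k → Vec (Term n) k → Formula n
    ¬ᶠ_            : Formula n → Formula n
    _∧ᶠ_ _∨ᶠ_ _⇒ᶠ_ : Formula n → Formula n → Formula n
    ∃ᶠ_ ∀ᶠ_        : Formula (suc n) → Formula n

record Structure {f r : Level} (L : Language f r) (R : Set) : Set (f ⊔ r ⊔ lsuc 0ℓ) where
  open Language L
  field
    ⟦_⟧ᶠ : ∀ {k} → FunSym k → Vec R k → R
    ⟦_⟧ʳ : ∀ {k} → RelSym k → Pred (Vec R k) 0ℓ

module _ {f r : Level} {L : Language f r} {R : Set} (M : Structure L R) where
  open Structure M

  mutual
    eval : ∀ {n} → Vec R n → Term L n → R
    eval v (var i)    = lookup v i
    eval v (app g ts) = ⟦ g ⟧ᶠ (evals v ts)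

    evals : ∀ {n k} → Vec R n → Vec (Term L n) k → Vec R k
    evals v []       = []
    evals v (t ∷ ts) = eval v t ∷ evals v ts

  Sat : ∀ {n} → Formula L n → Pred (Vec R n) 0ℓ
  Sat ⊥ᶠ         v = ⊥
  Sat (s ≐ t)    v = eval v s ≡ eval v t
  Sat (rel P ts) v = ⟦ P ⟧ʳ (evals v ts)
  Sat (¬ᶠ φ)     v = ¬ Sat φ v
  Sat (φ ∧ᶠ ψ)   v = Sat φ v × Sat ψ v
  Sat (φ ∨ᶠ ψ)   v = Sat φ v ⊎ Sat ψ v
  Sat (φ ⇒ᶠ ψ)   v = Sat φ v → Sat ψ v
  Sat (∃ᶠ φ)     v = ∃[ x ] Sat φ (x ∷ v)
  Sat (∀ᶠ φ)     v = ∀ x → Sat φ (x ∷ v)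

  -- Definability with parameters; the parameters are the vector c.
  Definable : ∀ {n} → Pred (Vec R n) 0ℓ → Set (f ⊔ r)
  Definable {n} U =
    ∃[ m ] Σ[ φ ∈ Formula L (n + m) ] Σ[ c ∈ Vec R m ]
      (∀ v → U v ⇔ Sat φ (v ++ c))

------------------------------------------------------------------------
-- Order topology, open core, o-minimality

module Ordered {R : Set} (_<_ : Rel R 0ℓ) where
  open AddExtrema _<_ using (_<±_)

  -- (a , b) stands for the open interval with endpoints a and b in R ∪ {±∞}.
  Interval : Set
  Interval = R ± × R ±

  infix 4 _∈ᴵ_ _∈ᴮ_ _∈ᴾ_

  _∈ᴵ_ : R → Interval → Set
  x ∈ᴵ (a , b) = a <± [ x ] × [ x ] <± b

  _∈ᴮ_ : ∀ {n} → Vec R n → Vec Interval n → Set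
  v ∈ᴮ B = Pointwise _∈ᴵ_ v B

  -- When _<_ is a linear order (as for ℚ and ℚ⁻ below), open intervals with
  -- endpoints in R ∪ {±∞} form a basis of the order topology, and hence
  -- products of them form a basis of the product topology.
  Open : ∀ {n} → Pred (Vec R n) 0ℓ → Set
  Open U = ∀ v → U v → ∃[ B ] (v ∈ᴮ B × (_∈ᴮ B) ⊆ U)

  Dense : Pred R 0ℓ → Set
  Dense D = ∀ I → Satisfiable (_∈ᴵ I) → ∃[ x ] (x ∈ᴵ I × D x)

  Codense : Pred R 0ℓ → Set
  Codense D = Dense (∁ D)

  module _ {f r : Level} {L : Language f r} (M : Structure L R) where

    openCoreLanguage : Language 0ℓ (f ⊔ r ⊔ lsuc 0ℓ)
    openCoreLanguage = record
      { FunSym = λ _ → ⊥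
      ; RelSym = λ n → Σ[ U ∈ Pred (Vec R n) 0ℓ ] (Open U × Definable M U)
      }

    openCore : Structure openCoreLanguage R
    openCore = record
      { ⟦_⟧ᶠ = λ ()
      ; ⟦_⟧ʳ = proj₁
      }

  data Piece : Set where
    point    : R → Piece
    interval : Interval → Piece

  _∈ᴾ_ : R → Piece → Set
  x ∈ᴾ point a    = x ≡ a
  x ∈ᴾ interval I = x ∈ᴵ I

  FiniteUnion : Pred R 0ℓ → Set
  FiniteUnion S = Σ[ ps ∈ List Piece ] (∀ x → S x ⇔ ListAny.Any (x ∈ᴾ_) ps)

  -- A subset of R is regarded as a subset of R¹ through Vec.head.
  OMinimal : ∀ {f r} {L : Language f r} → Structure L R → Set (f ⊔ r ⊔ lsuc 0ℓ)
  OMinimal M = ∀ (S : Pred R 0ℓ) → Definable M {1} (S ∘ Vec.head) → FiniteUnion S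

------------------------------------------------------------------------
-- The structure (ℚ, <, 0, A)

-- The order on ℚ is proof-irrelevant, so these are honest subsets of ℚ.
ℚ⁻ ℚ⁺ : Set
ℚ⁻ = Σ[ x ∈ ℚ ] x ℚ.< 0ℚ
ℚ⁺ = Σ[ y ∈ ℚ ] 0ℚ ℚ.< y

-- ℚ⁻ is convex in ℚ, so the order topology of _<⁻_ is the subspace topology.
_<⁻_ : Rel ℚ⁻ 0ℓ
_<⁻_ = ℚ._<_ on proj₁

-- A finite subset of ℚ⁺ is given by a list of its elements; two lists are
-- the same finite subset when they have the same members (_∼[ set ]_).
𝓕 : Set
𝓕 = List ℚ⁺

Fiber : (ℚ⁻ → 𝓕) → 𝓕 → Pred ℚ⁻ 0ℓ
Fiber ρ F x = ρ x ∼[ set ] F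

data Constant : ℕ → Set where
  `0 : Constant 0

data Relation : ℕ → Set where
  `< `A : Relation 2

𝓛 : Language 0ℓ 0ℓ
𝓛 = record { FunSym = Constant ; RelSym = Relation }

A[_] : (ℚ⁻ → 𝓕) → Rel ℚ 0ℓ
A[ ρ ] x y = Σ[ x<0 ∈ x ℚ.< 0ℚ ] Σ[ 0<y ∈ 0ℚ ℚ.< y ] (y , 0<y) ∈ ρ (x , x<0)

𝓠 : (ℚ⁻ → 𝓕) → Structure 𝓛 ℚ
𝓠 ρ = record
  { ⟦_⟧ᶠ = λ { `0 [] → 0ℚ }
  ; ⟦_⟧ʳ = λ { `< (x ∷ y ∷ []) → x ℚ.< y
             ; `A (x ∷ y ∷ []) → A[ ρ ] x y }
  }

{-# OPTIONS --safe #-}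
module Submission where

-- A negative point codes a finite set of positive points, and every code is
-- dense. Hence a finite partial order isomorphism that fixes 0 and respects A
-- extends to any further point: to a negative x by first extending to ρ(x) and
-- then picking a point coded by the image of ρ(x) in the prescribed gap. Such
-- maps therefore preserve all formulas of (ℚ,<,0,A).
--
-- If U is open, respecting A is not needed. Let C contain 0, the parameters
-- of U and the sets they code, and let v ↦ w be a partial order isomorphism
-- that fixes C, with w ∈ U. By density the negative entries of w can be moved,
-- inside a box around w contained in U and without changing their order, to
-- points whose codes match those of v. The new w′ ∈ U satisfies the same
-- formulas over C as v, so v ∈ U. Consequently a set definable in the open
-- core is invariant under partial order isomorphisms that fix a finite set, and
-- is a union of cells cut out by that set.

open import Defs
open import Axiom.ExcludedMiddle using (ExcludedMiddle)
open import Data.Product.Base using (_×_)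
open import Data.Rational.Base using (ℚ; _<_)
open import Level using (0ℓ)

open import Data.Empty using (⊥; ⊥-elim)
open import Data.Fin.Base using (Fin; zero; suc)
open import Data.List.Base using (List; []; _∷_; _++_; map; filter; concatMap; allFin)
open import Data.List.Membership.Propositional using (_∈_; lose; find)
open import Data.List.Membership.Propositional.Properties
  using (∈-map⁺; ∈-map⁻; ∈-++⁺ˡ; ∈-++⁺ʳ; ∈-++⁻; ∈-filter⁺; ∈-filter⁻;
         ∈-concatMap⁺; ∈-concatMap⁻; ∈-allFin)
open import Data.List.Relation.Binary.Subset.Propositional using (_⊆_)
open import Data.List.Relation.Binary.Subset.Propositional.Properties using (map⁺)
open import Data.List.Relation.Unary.Any using (Any; here; there)
import Data.List.Relation.Unary.Any.Properties as Any
open import Data.Nat.Base using (ℕ)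
open import Data.Product.Base using (Σ; Σ-syntax; ∃-syntax; _,_; proj₁; proj₂; swap)
open import Data.Rational.Base using (0ℚ; 1ℚ; _≤_; _+_; -_; _⊓_; _⊔_)
open import Data.Rational.Properties
open import Data.Sum.Base using (_⊎_; inj₁; inj₂; [_,_]′)
open import Data.Vec.Base as Vec using (Vec; []; _∷_; lookup; tabulate; toList)
open import Data.Vec.Relation.Binary.Pointwise.Inductive as Pointwise using (Pointwise; []; _∷_)
open import Function.Base using (id; _∘_)
open import Function.Bundles using (_⇔_; mk⇔; module Equivalence)
open import Relation.Binary.Definitions using (tri<; tri≈; tri>)
open import Relation.Binary.PropositionalEquality.Core using (_≡_; _≢_; refl; sym; subst)
import Relation.Binary.Construct.Add.Extrema.Strict as AddExtrema
open import Relation.Nullary.Construct.Add.Extrema using (⊥±; ⊤±; [_])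
open import Relation.Nullary.Decidable.Core using (yes; no; from-yes)
open import Relation.Nullary.Negation.Core using (¬_)
open import Relation.Unary using (Pred)

open Equivalence using (to; from)
open Ordered _<_
open AddExtrema _<_ using (_<±_; ⊥±<[_]; [_]<⊤±)
  renaming ([_] to [_]<)

-- Back-and-forth

Pairs : Set → Set
Pairs R = List (R × R)

Match : ∀ {R n} → Pairs R → Vec R n → Vec R n → Set
Match p = Pointwise (λ a b → (a , b) ∈ p)

∈-swap : ∀ {R : Set} {p : Pairs R} {a b} → (a , b) ∈ p → (b , a) ∈ map swap p
∈-swap = ∈-map⁺ swap

∈-swap⁻ : ∀ {R : Set} {p : Pairs R} {a b} → (a , b) ∈ map swap p → (b , a) ∈ p
∈-swap⁻ h with ∈-map⁻ swap h
... | _ , h′ , refl = h′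

match-swap : ∀ {R n} {p : Pairs R} {v w : Vec R n} → Match p v w → Match (map swap p) w v
match-swap = Pointwise.sym ∈-swap

match-⊆ : ∀ {R n} {p q : Pairs R} {v w : Vec R n} → p ⊆ q → Match p v w → Match q v w
match-⊆ s = Pointwise.map s

-- The open core has a symbol for every open definable set, yet a formula uses finitely many.
-- Listing them is what lets a finite set of points support the formula.
rels : ∀ {f r} {L : Language f r} {n} → Formula L n → List (Σ ℕ (Language.RelSym L))
rels ⊥ᶠ              = []
rels (s ≐ t)         = []
rels (rel {k} P ts)  = (k , P) ∷ []
rels (¬ᶠ φ)          = rels φ
rels (φ ∧ᶠ ψ)        = rels φ ++ rels ψ
rels (φ ∨ᶠ ψ)        = rels φ ++ rels ψ
rels (φ ⇒ᶠ ψ)        = rels φ ++ rels ψ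
rels (∃ᶠ φ)          = rels φ
rels (∀ᶠ φ)          = rels φ

-- Since the system is closed under inversion, `Sys-forth` also gives the back condition, and
-- preserving relations in one direction is enough: `transfer` inverts the map at negations and
-- hypotheses.
module BackAndForth {f r} {L : Language f r} {R : Set} (M : Structure L R)
  (Sys : Pred (Pairs R) 0ℓ)
  (Sys-swap : ∀ {p} → Sys p → Sys (map swap p))
  (Sys-func : ∀ {p a b c} → Sys p → (a , b) ∈ p → (a , c) ∈ p → b ≡ c)
  (Sys-forth : ∀ {p} → Sys p → ∀ x → ∃[ y ] ∃[ q ] (Sys q × p ⊆ q × (x , y) ∈ q))
  where
  open Language L
  open Structure M

  PreservesFun : ∀ {k} → FunSym k → Set
  PreservesFun g = ∀ {p v w} → Sys p → Match p v w → (⟦ g ⟧ᶠ v , ⟦ g ⟧ᶠ w) ∈ p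

  PreservesRel : ∀ {k} → RelSym k → Set
  PreservesRel P = ∀ {p v w} → Sys p → Match p v w → ⟦ P ⟧ʳ v → ⟦ P ⟧ʳ w

  module _ (pres-fun : ∀ {k} (g : FunSym k) → PreservesFun g) where

    mutual
      eval-match : ∀ {n p} {v w : Vec R n} → Sys p → Match p v w →
                   ∀ t → (eval M v t , eval M w t) ∈ p
      eval-match s m (var i)    = Pointwise.lookup m i
      eval-match s m (app g ts) = pres-fun g s (evals-match s m ts)

      evals-match : ∀ {n k p} {v w : Vec R n} → Sys p → Match p v w →
                    (ts : Vec (Term L n) k) → Match p (evals M v ts) (evals M w ts)
      evals-match s m []       = []
      evals-match s m (t ∷ ts) = eval-match s m t ∷ evals-match s m ts

    transfer : ∀ {n} (φ : Formula L n) →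
               (∀ {k} {P : RelSym k} → (k , P) ∈ rels φ → PreservesRel P) →
               ∀ {p v w} → Sys p → Match p v w → Sat M φ v → Sat M φ w
    transfer (t ≐ u) pr s m e =
      Sys-func s (subst (λ a → (a , _) ∈ _) e (eval-match s m t)) (eval-match s m u)
    transfer (rel P ts) pr s m h = pr (here refl) s (evals-match s m ts) h
    transfer (¬ᶠ φ) pr s m h = h ∘ transfer φ pr (Sys-swap s) (match-swap m)
    transfer (φ ∧ᶠ ψ) pr s m (h , k) =
      transfer φ (pr ∘ ∈-++⁺ˡ) s m h , transfer ψ (pr ∘ ∈-++⁺ʳ (rels φ)) s m k
    transfer (φ ∨ᶠ ψ) pr s m (inj₁ h) = inj₁ (transfer φ (pr ∘ ∈-++⁺ˡ) s m h)
    transfer (φ ∨ᶠ ψ) pr s m (inj₂ h) = inj₂ (transfer ψ (pr ∘ ∈-++⁺ʳ (rels φ)) s m h)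
    transfer (φ ⇒ᶠ ψ) pr s m h =
      transfer ψ (pr ∘ ∈-++⁺ʳ (rels φ)) s m ∘ h ∘
      transfer φ (pr ∘ ∈-++⁺ˡ) (Sys-swap s) (match-swap m)
    transfer (∃ᶠ φ) pr s m (x , h) =
      let y , q , s′ , p⊆q , xy = Sys-forth s x
      in  y , transfer φ pr s′ (xy ∷ match-⊆ p⊆q m) h
    transfer (∀ᶠ φ) pr s m h y =
      let x , q , s′ , p⊆q , yx = Sys-forth (Sys-swap s) y
      in  transfer φ pr (Sys-swap s′) (∈-swap yx ∷ match-swap (match-⊆ p⊆q (match-swap m))) (h x)

-- The order of ℚ

q-1<q : ∀ q → q + - 1ℚ < q
q-1<q q = subst (q + - 1ℚ <_) (+-identityʳ q) (+-monoʳ-< q (from-yes (- 1ℚ <? 0ℚ)))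

q<q+1 : ∀ q → q < q + 1ℚ
q<q+1 q = subst (_< q + 1ℚ) (+-identityʳ q) (+-monoʳ-< q (from-yes (0ℚ <? 1ℚ)))

<⇒≱ : ∀ {a b} → a < b → ¬ b ≤ a
<⇒≱ a<b b≤a = <-irrefl refl (<-≤-trans a<b b≤a)

<-⊓ : ∀ {a b c} → a < b → a < c → a < b ⊓ c
<-⊓ {a} {b} {c} h k = [ (λ e → subst (a <_) (sym e) h) , (λ e → subst (a <_) (sym e) k) ]′ (⊓-sel b c)

⊔-< : ∀ {a b c} → a < c → b < c → a ⊔ b < c
⊔-< {a} {b} {c} h k = [ (λ e → subst (_< c) (sym e) h) , (λ e → subst (_< c) (sym e) k) ]′ (⊔-sel a b)

lower-bound : ∀ H → ∃[ l ] (∀ {h} → h ∈ H → l < h)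
lower-bound [] = 0ℚ , λ ()
lower-bound (h ∷ H) =
  let l , l<H = lower-bound H
      m = (h + - 1ℚ) ⊓ l
  in  m , λ { (here refl) → ≤-<-trans (p⊓q≤p _ l) (q-1<q h)
            ; (there k)   → ≤-<-trans (p⊓q≤q (h + - 1ℚ) l) (l<H k) }

-- Allowing `m` to be attained in `L` makes a maximum work, started at a lower bound of `H` to cover
-- the empty list. `separate-right` then adds `n`, and every point strictly between `m` and `n`
-- separates the lists.
separate-left : ∀ L H → (∀ {l h} → l ∈ L → h ∈ H → l < h) →
                ∃[ m ] ((∀ {l} → l ∈ L → l ≤ m) × (∀ {h} → h ∈ H → m < h))
separate-left [] H L<H = let m , m<H = lower-bound H in m , (λ ()) , m<H
separate-left (l ∷ L) H L<H =
  let m , L≤m , m<H = separate-left L H (L<H ∘ there)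
  in  l ⊔ m
    , (λ { (here refl) → p≤p⊔q l m ; (there k) → ≤-trans (L≤m k) (p≤q⊔p l m) })
    , (λ k → ⊔-< (L<H (here refl) k) (m<H k))

separate-right : ∀ m H → (∀ {h} → h ∈ H → m < h) → ∃[ n ] (m < n × (∀ {h} → h ∈ H → n ≤ h))
separate-right m [] m<H = m + 1ℚ , q<q+1 m , λ ()
separate-right m (h ∷ H) m<H =
  let n , m<n , n≤H = separate-right m H (m<H ∘ there)
  in  h ⊓ n , <-⊓ (m<H (here refl)) m<n
    , λ { (here refl) → p⊓q≤p h n ; (there k) → ≤-trans (p⊓q≤q h n) (n≤H k) }

-- Neighbourhoods of a rational number

Near : ℚ → Pred ℚ 0ℓ → Set
Near a P = ∃[ l ] ∃[ h ] (l < a × a < h × (∀ {x} → l < x → x < h → P x))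

near-all : ∀ {a} {P : Pred ℚ 0ℓ} → (∀ x → P x) → Near a P
near-all {a} h = _ , _ , q-1<q a , q<q+1 a , λ {x} _ _ → h x

near-map : ∀ {a} {P Q : Pred ℚ 0ℓ} → (∀ {x} → P x → Q x) → Near a P → Near a Q
near-map f (l , h , l<a , a<h , P) = l , h , l<a , a<h , λ u v → f (P u v)

near-× : ∀ {a} {P Q : Pred ℚ 0ℓ} → Near a P → Near a Q → Near a (λ x → P x × Q x)
near-× (l , h , l<a , a<h , P) (l′ , h′ , l′<a , a<h′ , Q) =
  l ⊔ l′ , h ⊓ h′ , ⊔-< l<a l′<a , <-⊓ a<h a<h′ , λ u v →
    P (≤-<-trans (p≤p⊔q l l′) u) (<-≤-trans v (p⊓q≤p h h′)) ,
    Q (≤-<-trans (p≤q⊔p l l′) u) (<-≤-trans v (p⊓q≤q h h′))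

near-> : ∀ {a l} → l < a → Near a (l <_)
near-> {a} {l} l<a = l , a + 1ℚ , l<a , q<q+1 a , λ u _ → u

near-< : ∀ {a h} → a < h → Near a (_< h)
near-< {a} {h} a<h = a + - 1ℚ , h , q-1<q a , a<h , λ _ u → u

-- Finitely many requirements on a point are gathered into one neighbourhood, so that a single use
-- of density meets them all.
near-⋂ : ∀ {A : Set} {a} (ds : List A) {P : A → Pred ℚ 0ℓ} →
         (∀ {d} → d ∈ ds → Near a (P d)) → Near a (λ x → ∀ {d} → d ∈ ds → P d x)
near-⋂ [] h = near-all (λ _ → λ ())
near-⋂ (d ∷ ds) h =
  near-map (λ { (u , v) (here refl) → u ; (u , v) (there k) → v k })
    (near-× (h (here refl)) (near-⋂ ds (h ∘ there)))

near-interval : ∀ {x} I → x ∈ᴵ I → Near x (_∈ᴵ I)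
near-interval {x} (a , b) (a<x , x<b) = near-× (above a<x) (below x<b)
  where
  above : ∀ {a} → a <± [ x ] → Near x (λ y → a <± [ y ])
  above ⊥±<[ _ ] = near-all ⊥±<[_]
  above [ h ]<   = near-map [_]< (near-> h)
  below : ∀ {b} → [ x ] <± b → Near x (λ y → [ y ] <± b)
  below [ _ ]<⊤± = near-all [_]<⊤±
  below [ h ]<   = near-map [_]< (near-< h)

near-self : ∀ {a P} → Near a P → P a
near-self (_ , _ , u , v , P) = P u v

-- Finite partial isomorphisms of (ℚ, <)

-- Asking for both directions makes the notion symmetric under `swap` and, by trichotomy, forces `p`
-- to be single-valued and injective.
record Iso (p : Pairs ℚ) : Set where
  field
    mono  : ∀ {a b c d} → (a , b) ∈ p → (c , d) ∈ p → a < c → b < d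
    mono⁻ : ∀ {a b c d} → (a , b) ∈ p → (c , d) ∈ p → b < d → a < c

  func : ∀ {a b d} → (a , b) ∈ p → (a , d) ∈ p → b ≡ d
  func {a} {b} {d} h k with <-cmp b d
  ... | tri< u _ _ = ⊥-elim (<-irrefl refl (mono⁻ h k u))
  ... | tri≈ _ u _ = u
  ... | tri> _ _ u = ⊥-elim (<-irrefl refl (mono⁻ k h u))

open Iso

iso-swap : ∀ {p} → Iso p → Iso (map swap p)
iso-swap i = record
  { mono  = λ h k → mono⁻ i (∈-swap⁻ h) (∈-swap⁻ k)
  ; mono⁻ = λ h k → mono i (∈-swap⁻ h) (∈-swap⁻ k)
  }

iso-⊆ : ∀ {p q} → p ⊆ q → Iso q → Iso p
iso-⊆ s i = record { mono = λ h k → mono i (s h) (s k) ; mono⁻ = λ h k → mono⁻ i (s h) (s k) }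

SameSide : (x y a b : ℚ) → Set
SameSide x y a b = (x < a → y < b) × (a < x → b < y) × x ≢ a

-- `SameSide` gives one-way implications only; as `x` differs from every old first coordinate,
-- trichotomy yields the converses.
iso-∷ : ∀ {p x y} → Iso p → (∀ {a b} → (a , b) ∈ p → SameSide x y a b) → Iso ((x , y) ∷ p)
iso-∷ {p} {x} {y} i side = record { mono = mono′ ; mono⁻ = mono⁻′ }
  where
  mono′ : ∀ {a b c d} → (a , b) ∈ (x , y) ∷ p → (c , d) ∈ (x , y) ∷ p → a < c → b < d
  mono′ (here refl) (here refl) u = ⊥-elim (<-irrefl refl u)
  mono′ (here refl) (there k)   u = proj₁ (side k) u
  mono′ (there h)   (here refl) u = proj₁ (proj₂ (side h)) u
  mono′ (there h)   (there k)   u = mono i h k u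
  mono⁻′ : ∀ {a b c d} → (a , b) ∈ (x , y) ∷ p → (c , d) ∈ (x , y) ∷ p → b < d → a < c
  mono⁻′ (here refl) (here refl) u = ⊥-elim (<-irrefl refl u)
  mono⁻′ {c = c} (here refl) (there k) u with <-cmp x c | side k
  ... | tri< v _ _ | _           = v
  ... | tri≈ _ v _ | _ , _ , x≢c = ⊥-elim (x≢c v)
  ... | tri> _ _ v | _ , gt , _  = ⊥-elim (<-asym u (gt v))
  mono⁻′ {a = a} (there h) (here refl) u with <-cmp a x | side h
  ... | tri< v _ _ | _           = v
  ... | tri≈ _ v _ | _ , _ , x≢a = ⊥-elim (x≢a (sym v))
  ... | tri> _ _ v | lt , _      = ⊥-elim (<-asym u (lt v))
  mono⁻′ (there h) (there k) u = mono⁻ i h k u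

-- A whole interval of images is returned, not one point, so that density of a fiber can still pick
-- an image with a prescribed code in it.
gap : ∀ {p} → Iso p → ∀ x → (∀ {y} → ¬ (x , y) ∈ p) →
      ∃[ m ] ∃[ n ] (m < n × (∀ {y} → m < y → y < n → Iso ((x , y) ∷ p)))
gap {p} i x new =
  let m , L≤m , m<H = separate-left L H L<H
      n , m<n , n≤H = separate-right m H m<H
  in  m , n , m<n , λ m<y y<n → iso-∷ i λ ab →
        (λ x<a → <-≤-trans y<n (n≤H (∈-map⁺ proj₂ (∈-filter⁺ above? ab x<a)))) ,
        (λ a<x → ≤-<-trans (L≤m (∈-map⁺ proj₂ (∈-filter⁺ below? ab a<x))) m<y) ,
        (λ { refl → new ab })
  where
  below? = λ (e : ℚ × ℚ) → proj₁ e <? x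
  above? = λ (e : ℚ × ℚ) → x <? proj₁ e
  L = map proj₂ (filter below? p)
  H = map proj₂ (filter above? p)
  L<H : ∀ {l h} → l ∈ L → h ∈ H → l < h
  L<H l∈L h∈H with ∈-map⁻ proj₂ l∈L | ∈-map⁻ proj₂ h∈H
  ... | _ , u , refl | _ , v , refl =
    let u∈p , a<x = ∈-filter⁻ below? {xs = p} u
        v∈p , x<c = ∈-filter⁻ above? {xs = p} v
    in  mono i u∈p v∈p (<-trans a<x x<c)

±-trans : ∀ {a b c} → a <± b → b <± c → a <± c
±-trans = AddExtrema.<±-trans _<_ <-trans

module _ (em : ExcludedMiddle 0ℓ) where

  iso-forth : ∀ {p} → Iso p → ∀ x → ∃[ y ] ∃[ q ] (Iso q × p ⊆ q × (x , y) ∈ q)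
  iso-forth {p} i x with em {∃[ y ] (x , y) ∈ p}
  ... | yes (y , xy) = y , p , i , id , xy
  ... | no new =
    let m , n , m<n , ext = gap i x (λ h → new (_ , h))
        y , m<y , y<n = <-dense m<n
    in  y , _ , ext m<y y<n , there , here refl

  -- Sets invariant over a finite set of points

  -- This is equality of order types over `C`: by trichotomy the one-way implications entail their
  -- converses.
  Same : List ℚ → ℚ → ℚ → Set
  Same C x y = ∀ {c} → c ∈ C → (x < c → y < c) × (c < x → c < y) × (x ≡ c → y ≡ c)

  same-outside : ∀ {c x y} I → ¬ c ∈ᴵ I → x ∈ᴵ I → y ∈ᴵ I →
                 (x < c → y < c) × (c < x → c < y) × (x ≡ c → y ≡ c)
  same-outside {c} {x} {y} (a , b) c∉I x∈I y∈I = below , above , λ { refl → ⊥-elim (c∉I x∈I) }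
    where
    between : ∀ {u v} → u ∈ᴵ (a , b) → v ∈ᴵ (a , b) → u < c → c < v → ⊥
    between (a<u , _) (_ , v<b) u<c c<v = c∉I (±-trans a<u [ u<c ]< , ±-trans [ c<v ]< v<b)
    below : x < c → y < c
    below x<c with <-cmp y c
    ... | tri< y<c _ _  = y<c
    ... | tri≈ _ refl _ = ⊥-elim (c∉I y∈I)
    ... | tri> _ _ c<y  = ⊥-elim (between x∈I y∈I x<c c<y)
    above : c < x → c < y
    above c<x with <-cmp y c
    ... | tri< y<c _ _  = ⊥-elim (between y∈I x∈I y<c c<x)
    ... | tri≈ _ refl _ = ⊥-elim (c∉I y∈I)
    ... | tri> _ _ c<y  = c<y

  module _ (S : Pred ℚ 0ℓ) where

    -- Induction on `C`: a point of `C` inside `I` cuts it into two intervals and a point, and a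
    -- point outside imposes no condition. Once `C` is exhausted, invariance makes `S` contain all
    -- of `I` or none of it.
    cells : ∀ C I → (∀ {x y} → x ∈ᴵ I → y ∈ᴵ I → Same C x y → S x → S y) →
            ∃[ ps ] (∀ x → (S x × x ∈ᴵ I) ⇔ Any (x ∈ᴾ_) ps)
    cells [] I inv with em {∃[ x ] (S x × x ∈ᴵ I)}
    ... | yes (x , x∈S , x∈I) = interval I ∷ [] , λ y →
      mk⇔ (here ∘ proj₂) (λ { (here y∈I) → inv x∈I y∈I (λ ()) x∈S , y∈I ; (there ()) })
    ... | no empty = [] , λ y → mk⇔ (λ y∈ → ⊥-elim (empty (y , y∈))) (λ ())
    cells (c ∷ C) I inv with em {c ∈ᴵ I}
    ... | no c∉I = cells C I λ x∈I y∈I same →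
      inv x∈I y∈I λ { (here refl) → same-outside I c∉I x∈I y∈I ; (there h) → same h }
    ... | yes (a<c , c<b) = ps ++ ms ++ qs , λ x → mk⇔ (into x) (out x)
      where
      a = proj₁ I
      b = proj₂ I
      widenˡ : ∀ {x} → x ∈ᴵ (a , [ c ]) → x ∈ᴵ I
      widenˡ (a<x , x<c) = a<x , ±-trans x<c c<b
      widenʳ : ∀ {x} → x ∈ᴵ ([ c ] , b) → x ∈ᴵ I
      widenʳ (c<x , x<b) = ±-trans a<c c<x , x<b
      left = cells C (a , [ c ]) λ { x∈@(_ , [ x<c ]<) y∈@(_ , [ y<c ]<) same →
        inv (widenˡ x∈) (widenˡ y∈)
          λ { (here refl) → (λ _ → y<c) , (λ c<x → ⊥-elim (<-asym x<c c<x)) , (λ { refl → ⊥-elim (<-irrefl refl x<c) })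
            ; (there h)   → same h } }
      right = cells C ([ c ] , b) λ { x∈@([ c<x ]< , _) y∈@([ c<y ]< , _) same →
        inv (widenʳ x∈) (widenʳ y∈)
          λ { (here refl) → (λ x<c → ⊥-elim (<-asym x<c c<x)) , (λ _ → c<y) , (λ { refl → ⊥-elim (<-irrefl refl c<x) })
            ; (there h)   → same h } }
      middle : ∃[ ms ] (∀ x → (S x × x ≡ c) ⇔ Any (x ∈ᴾ_) ms)
      middle with em {S c}
      ... | yes c∈S = point c ∷ [] , λ x → mk⇔ (here ∘ proj₂) (λ { (here refl) → c∈S , refl ; (there ()) })
      ... | no c∉S  = [] , λ x → mk⇔ (λ { (x∈S , refl) → ⊥-elim (c∉S x∈S) }) (λ ())
      ps = proj₁ left
      ms = proj₁ middle
      qs = proj₁ right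
      into : ∀ x → S x × x ∈ᴵ I → Any (x ∈ᴾ_) (ps ++ ms ++ qs)
      into x (x∈S , a<x , x<b) with <-cmp x c
      ... | tri< x<c _ _ = Any.++⁺ˡ (to (proj₂ left x) (x∈S , a<x , [ x<c ]<))
      ... | tri≈ _ x≡c _ = Any.++⁺ʳ ps (Any.++⁺ˡ (to (proj₂ middle x) (x∈S , x≡c)))
      ... | tri> _ _ c<x = Any.++⁺ʳ ps (Any.++⁺ʳ ms (to (proj₂ right x) (x∈S , [ c<x ]< , x<b)))
      out : ∀ x → Any (x ∈ᴾ_) (ps ++ ms ++ qs) → S x × x ∈ᴵ I
      out x h with Any.++⁻ ps h
      ... | inj₁ k = let x∈S , x∈ = from (proj₂ left x) k in x∈S , widenˡ x∈
      ... | inj₂ h′ with Any.++⁻ ms h′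
      ...   | inj₂ k = let x∈S , x∈ = from (proj₂ right x) k in x∈S , widenʳ x∈
      ...   | inj₁ k with from (proj₂ middle x) k
      ...     | x∈S , refl = x∈S , a<c , c<b

    finite-union : ∀ C → (∀ {x y} → Same C x y → S x → S y) → FiniteUnion S
    finite-union C inv =
      let ps , union = cells C (⊥± , ⊤±) (λ _ _ → inv)
      in  ps , λ x → mk⇔ (λ x∈S → to (union x) (x∈S , ⊥±<[ x ] , [ x ]<⊤±)) (proj₁ ∘ from (union x))

  module _ (ρ : ℚ⁻ → 𝓕) (dense : ∀ F → Ordered.Dense _<⁻_ (Fiber ρ F)) where

    A-member : ∀ {x y} (x<0 : x < 0ℚ) → A[ ρ ] x y → ∃[ 0<y ] (y , 0<y) ∈ ρ (x , x<0)
    A-member x<0 (x<0′ , 0<y , h) with <-irrelevant x<0 x<0′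
    ... | refl = 0<y , h

    dense-near : ∀ {b} {P : Pred ℚ 0ℓ} F → b < 0ℚ → Near b P →
                 ∃[ x ] Σ[ x<0 ∈ x < 0ℚ ] (P x × Fiber ρ F (x , x<0))
    dense-near {b} {P} F b<0 (l , h , l<b , b<h , P-near) with h <? 0ℚ
    ... | yes h<0 with dense F ([ l , <-trans l<b b<0 ] , [ h , h<0 ]) ((b , b<0) , [ l<b ]< , [ b<h ]<)
    ...   | (x , x<0) , ([ l<x ]< , [ x<h ]<) , x∈F = x , x<0 , P-near l<x x<h , x∈F
    dense-near {b} {P} F b<0 (l , h , l<b , b<h , P-near) | no h≮0
      with dense F ([ l , <-trans l<b b<0 ] , ⊤±) ((b , b<0) , [ l<b ]< , [ _ ]<⊤±)
    ...   | (x , x<0) , ([ l<x ]< , _) , x∈F =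
            x , x<0 , P-near l<x (<-≤-trans x<0 (≮⇒≥ h≮0)) , x∈F

    -- Partial isomorphisms respecting A

    -- Stronger than preserving `A`: whenever a point is in the domain, so is its whole code, and
    -- likewise for the range. A positive point added later thus belongs to no code of an old point,
    -- so its image can be chosen by order alone.
    record Good (p : Pairs ℚ) : Set where
      field
        iso       : Iso p
        zeros     : (0ℚ , 0ℚ) ∈ p
        coherent  : ∀ {a b u} → (a , b) ∈ p → A[ ρ ] a u → ∃[ v ] ((u , v) ∈ p × A[ ρ ] b v)
        coherent⁻ : ∀ {a b v} → (a , b) ∈ p → A[ ρ ] b v → ∃[ u ] ((u , v) ∈ p × A[ ρ ] a u)

    open Good

    good-swap : ∀ {p} → Good p → Good (map swap p)
    good-swap g = record
      { iso       = iso-swap (iso g)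
      ; zeros     = ∈-swap (zeros g)
      ; coherent  = λ h k → let v , i , j = coherent⁻ g (∈-swap⁻ h) k in v , ∈-swap i , j
      ; coherent⁻ = λ h k → let u , i , j = coherent g (∈-swap⁻ h) k in u , ∈-swap i , j
      }

    negative : ∀ {p a b} → Good p → (a , b) ∈ p → a < 0ℚ → b < 0ℚ
    negative g h = mono (iso g) h (zeros g)

    negative⁻ : ∀ {p a b} → Good p → (a , b) ∈ p → b < 0ℚ → a < 0ℚ
    negative⁻ g h = mono⁻ (iso g) h (zeros g)

    -- Matching a code adds only positive points. Keeping track of this guarantees that a negative
    -- point awaiting its image is still new afterwards.
    _≤₊_ : Pairs ℚ → Pairs ℚ → Set
    p ≤₊ q = p ⊆ q × (∀ {a b} → (a , b) ∈ q → a < 0ℚ → (a , b) ∈ p)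

    good-forth⁺ : ∀ {p} → Good p → ∀ {x} → 0ℚ < x →
                  ∃[ y ] ∃[ q ] (Good q × p ≤₊ q × (x , y) ∈ q)
    good-forth⁺ {p} g {x} 0<x with em {∃[ y ] (x , y) ∈ p}
    ... | yes (y , xy) = y , p , g , (id , λ h _ → h) , xy
    ... | no new with gap (iso g) x (λ h → new (_ , h))
    ...   | m , n , m<n , ext with <-dense m<n
    ...     | y , m<y , y<n = y , (x , y) ∷ p , good , (there , old) , here refl
      where
      i = ext m<y y<n
      0<y : 0ℚ < y
      0<y = mono i (there (zeros g)) (here refl) 0<x
      old : ∀ {a b} → (a , b) ∈ (x , y) ∷ p → a < 0ℚ → (a , b) ∈ p
      old (here refl) x<0 = ⊥-elim (<-asym 0<x x<0)
      old (there h)   _   = h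
      good : Good ((x , y) ∷ p)
      good = record
        { iso       = i
        ; zeros     = there (zeros g)
        ; coherent  = λ { (here refl) (x<0 , _) → ⊥-elim (<-asym 0<x x<0)
                        ; (there h) k → let v , i , j = coherent g h k in v , there i , j }
        ; coherent⁻ = λ { (here refl) (y<0 , _) → ⊥-elim (<-asym 0<y y<0)
                        ; (there h) k → let u , i , j = coherent⁻ g h k in u , there i , j }
        }

    record Image (p : Pairs ℚ) (F G : 𝓕) : Set where
      field
        forth : ∀ {x} → x ∈ F → ∃[ y ] (y ∈ G × (proj₁ x , proj₁ y) ∈ p)
        back  : ∀ {y} → y ∈ G → ∃[ x ] (x ∈ F × (proj₁ x , proj₁ y) ∈ p)

    open Image

    good-image : ∀ {p} → Good p → ∀ F → ∃[ G ] ∃[ q ] (Good q × p ≤₊ q × Image q F G)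
    good-image {p} g [] = [] , p , g , (id , λ h _ → h) , record { forth = λ () ; back = λ () }
    good-image {p} g ((x , 0<x) ∷ F) with good-image g F
    ... | G , q , g′ , (p⊆q , old) , im with good-forth⁺ g′ 0<x
    ...   | y , r , g″ , (q⊆r , old′) , xy =
      (y , mono (iso g″) (zeros g″) xy 0<x) ∷ G , r , g″ ,
      (q⊆r ∘ p⊆q , λ h a<0 → old (old′ h a<0) a<0) , record
        { forth = λ { (here refl) → _ , here refl , xy
                    ; (there h) → let z , i , j = forth im h in z , there i , q⊆r j }
        ; back  = λ { (here refl) → _ , here refl , xy
                    ; (there h) → let z , i , j = back im h in z , there i , q⊆r j }
        }

    -- The members of the code of `y` are those of `G`, the image of the code of `x`, so the new
    -- pair is coherent both ways.
    good-∷ : ∀ {p G} → Good p → ∀ x y → Image p (ρ x) G → Fiber ρ G y →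
             Iso ((proj₁ x , proj₁ y) ∷ p) → Good ((proj₁ x , proj₁ y) ∷ p)
    good-∷ {p} g (x , x<0) (y , y<0) im y∈G i = record
      { iso       = i
      ; zeros     = there (zeros g)
      ; coherent  = λ { (here refl) k →
                          let _ , u∈ = A-member x<0 k
                              (v , 0<v) , v∈G , uv = forth im u∈
                          in  v , there uv , y<0 , 0<v , from y∈G v∈G
                      ; (there h) k → let v , i , j = coherent g h k in v , there i , j }
      ; coherent⁻ = λ { (here refl) k →
                          let _ , v∈ = A-member y<0 k
                              (u , 0<u) , u∈ , uv = back im (to y∈G v∈)
                          in  u , there uv , x<0 , 0<u , u∈
                      ; (there h) k → let u , i , j = coherent⁻ g h k in u , there i , j }
      }

    good-forth : ∀ {p} → Good p → ∀ x → ∃[ y ] ∃[ q ] (Good q × p ⊆ q × (x , y) ∈ q)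
    good-forth {p} g x with em {∃[ y ] (x , y) ∈ p} | <-cmp x 0ℚ
    ... | yes (y , xy) | _ = y , p , g , id , xy
    ... | no _ | tri≈ _ refl _ = 0ℚ , p , g , id , zeros g
    ... | no _ | tri> _ _ 0<x =
      let y , q , g′ , (p⊆q , _) , xy = good-forth⁺ g 0<x in y , q , g′ , p⊆q , xy
    ... | no new | tri< x<0 _ _ with good-image g (ρ (x , x<0))
    ...   | G , q , g′ , (p⊆q , old) , im with gap (iso g′) x (λ h → new (_ , old h x<0))
    ...     | m , n , m<n , ext with <-dense m<n
    -- `b` is provisional: compared with the pair of zeros it shows that the gap contains a negative
    -- point, around which the dense fiber over `G` supplies `y`.
    ...       | b , m<b , b<n with dense-near G (mono (ext m<b b<n) (here refl) (there (zeros g′)) x<0)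
                                                (near-× (near-> m<b) (near-< b<n))
    ...         | y , y<0 , (m<y , y<n) , y∈G =
      y , (x , y) ∷ q , good-∷ g′ (x , x<0) (y , y<0) im y∈G (ext m<y y<n) , there ∘ p⊆q , here refl

    module 𝓠-BF = BackAndForth (𝓠 ρ) Good good-swap (λ g → func (iso g)) good-forth

    𝓠-transfer : ∀ {n} (φ : Formula 𝓛 n) {p v w} → Good p → Match p v w →
                 Sat (𝓠 ρ) φ v → Sat (𝓠 ρ) φ w
    𝓠-transfer φ = 𝓠-BF.transfer pres-fun φ (λ {_} {P} _ → pres-rel P)
      where
      pres-fun : ∀ {k} (c : Constant k) → 𝓠-BF.PreservesFun c
      pres-fun `0 g [] = zeros g
      pres-rel : ∀ {k} (P : Relation k) → 𝓠-BF.PreservesRel P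
      pres-rel `< g (h ∷ k ∷ []) = mono (iso g) h k
      pres-rel `A g (h ∷ k ∷ []) a with coherent g h a
      ... | z , k′ , a′ with func (iso g) k k′
      ...   | refl = a′

    -- Perturbing negative points

    diag : List ℚ → Pairs ℚ
    diag = map (λ c → c , c)

    -- These are the conditions under which the identity on `C` satisfies `Good`.
    record Closed (C : List ℚ) : Set where
      field
        zero∈ : 0ℚ ∈ C
        A∈    : ∀ {c u} → c ∈ C → A[ ρ ] c u → u ∈ C

    open Closed

    -- `N b` is the room in which the partner `b` may move. By `N-sep` the rooms of distinct
    -- partners are ordered as the partners are, so independent moves keep the order.
    module Perturb {C p} (C-closed : Closed C) (C⊆p : diag C ⊆ p) (p-iso : Iso p)
      (N : ℚ → Pred ℚ 0ℓ)
      (N-near : ∀ {a b} → (a , b) ∈ p → Near b (N b))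
      (N-sep : ∀ {a b c d y z} → (a , b) ∈ p → (c , d) ∈ p → b < d → N b y → N d z → y < z)
      where

      zeros∈p : (0ℚ , 0ℚ) ∈ p
      zeros∈p = C⊆p (∈-map⁺ _ (zero∈ C-closed))

      nonneg? = λ (e : ℚ × ℚ) → 0ℚ ≤? proj₁ e

      -- This part stays put. Nonnegative points have no code and `C` contains the codes of its
      -- members, so it is coherent; the other negative pairs are restored one at a time with moved
      -- images.
      core : Pairs ℚ
      core = diag C ++ filter nonneg? p

      core⁻ : ∀ {a b} → (a , b) ∈ core → (a ∈ C × a ≡ b) ⊎ ((a , b) ∈ p × 0ℚ ≤ a)
      core⁻ h with ∈-++⁻ (diag C) h
      ... | inj₂ k = inj₂ (∈-filter⁻ nonneg? k)
      ... | inj₁ k with ∈-map⁻ _ k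
      ...   | _ , c∈C , refl = inj₁ (c∈C , refl)

      core⊆p : core ⊆ p
      core⊆p h with core⁻ h
      ... | inj₁ (c∈C , refl) = C⊆p (∈-map⁺ _ c∈C)
      ... | inj₂ (k , _)      = k

      core-good : Good core
      core-good = record
        { iso       = iso-⊆ core⊆p p-iso
        ; zeros     = diag⊆core (zero∈ C-closed)
        ; coherent  = coh
        ; coherent⁻ = coh⁻
        }
        where
        diag⊆core : ∀ {c} → c ∈ C → (c , c) ∈ core
        diag⊆core = ∈-++⁺ˡ ∘ ∈-map⁺ _
        coh : ∀ {a b u} → (a , b) ∈ core → A[ ρ ] a u → ∃[ v ] ((u , v) ∈ core × A[ ρ ] b v)
        coh h k with core⁻ h
        ... | inj₁ (c∈C , refl) = _ , diag⊆core (A∈ C-closed c∈C k) , k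
        ... | inj₂ (_ , 0≤a)    = ⊥-elim (<⇒≱ (proj₁ k) 0≤a)
        coh⁻ : ∀ {a b v} → (a , b) ∈ core → A[ ρ ] b v → ∃[ u ] ((u , v) ∈ core × A[ ρ ] a u)
        coh⁻ h k with core⁻ h
        ... | inj₁ (c∈C , refl) = _ , diag⊆core (A∈ C-closed c∈C k) , k
        ... | inj₂ (ab , 0≤a)   = ⊥-elim (<⇒≱ (mono⁻ p-iso ab zeros∈p (proj₁ k)) 0≤a)

      -- Limited to negative points because matching codes adds positive points that `p` may not
      -- contain.
      Perturbs : Pairs ℚ → Set
      Perturbs g = ∀ {a y} → (a , y) ∈ g → a < 0ℚ → ∃[ b ] ((a , b) ∈ p × N b y)

      -- After the code of `a` is matched, the image of `a` is taken from the right fiber inside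
      -- `N b`. The order is kept against negative points by `N-sep`, and against the others because
      -- `y` is negative.
      perturb-∷ : ∀ {a b g} → (a , b) ∈ p → a < 0ℚ → Good g → Perturbs g →
                  ∃[ y ] ∃[ q ] (Good q × g ⊆ q × Perturbs q × (a , y) ∈ q × N b y)
      perturb-∷ {a} {b} {g} ab a<0 good pert with em {∃[ y ] (a , y) ∈ g}
      ... | yes (y , ay) with pert ay a<0
      ...   | b′ , ab′ , y-near with func p-iso ab ab′
      ...     | refl = y , g , good , id , pert , ay , y-near
      perturb-∷ {a} {b} {g} ab a<0 good pert | no new with good-image good (ρ (a , a<0))
      ... | G , q , good′ , (g⊆q , old) , im
        with dense-near G (mono p-iso ab zeros∈p a<0) (N-near ab)
      ... | y , y<0 , y-near , y∈G =
        y , (a , y) ∷ q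
          , good-∷ good′ (a , a<0) (y , y<0) im y∈G (iso-∷ (iso good′) side)
          , there ∘ g⊆q
          , (λ { (here refl) _ → b , ab , y-near ; (there h) c<0 → pert (old h c<0) c<0 })
          , here refl , y-near
        where
        side : ∀ {c z} → (c , z) ∈ q → SameSide a y c z
        side {c} {z} h with c <? 0ℚ
        ... | yes c<0 = let d , cd , z-near = pert (old h c<0) c<0 in
          (λ a<c → N-sep ab cd (mono p-iso ab cd a<c) y-near z-near) ,
          (λ c<a → N-sep cd ab (mono p-iso cd ab c<a) z-near y-near) ,
          (λ { refl → new (z , old h c<0) })
        ... | no c≮0 =
          (λ _ → <-≤-trans y<0 (≮⇒≥ (c≮0 ∘ negative⁻ good′ h))) ,
          (λ c<a → ⊥-elim (c≮0 (<-trans c<a a<0))) ,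
          (λ { refl → c≮0 a<0 })

      perturb-list : ∀ q → q ⊆ p →
        ∃[ g ] (Good g × core ⊆ g × Perturbs g ×
                (∀ {a b} → (a , b) ∈ q → a < 0ℚ → ∃[ y ] ((a , y) ∈ g × N b y)))
      perturb-list [] _ = core , core-good , id , pert , λ ()
        where
        pert : Perturbs core
        pert h a<0 with core⁻ h
        ... | inj₁ (_ , refl) = _ , core⊆p h , near-self (N-near (core⊆p h))
        ... | inj₂ (_ , 0≤a)  = ⊥-elim (<⇒≱ a<0 0≤a)
      perturb-list ((a , b) ∷ q) q⊆p with perturb-list q (q⊆p ∘ there) | a <? 0ℚ
      ... | g , good , core⊆g , pert , moved | no a≮0 =
        g , good , core⊆g , pert , λ { (here refl) a<0 → ⊥-elim (a≮0 a<0) ; (there h) → moved h }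
      ... | g , good , core⊆g , pert , moved | yes a<0 with perturb-∷ (q⊆p (here refl)) a<0 good pert
      ...   | y , g′ , good′ , g⊆g′ , pert′ , ay , y-near =
        g′ , good′ , g⊆g′ ∘ core⊆g , pert′ ,
        λ { (here refl) _ → y , ay , y-near
          ; (there h) c<0 → let z , i , j = moved h c<0 in z , g⊆g′ i , j }

      perturb : ∃[ g ] (Good g × diag C ⊆ g × (∀ {a b} → (a , b) ∈ p → ∃[ y ] ((a , y) ∈ g × N b y)))
      perturb with perturb-list p id
      ... | g , good , core⊆g , _ , moved = g , good , core⊆g ∘ ∈-++⁺ˡ , all
        where
        all : ∀ {a b} → (a , b) ∈ p → ∃[ y ] ((a , y) ∈ g × N b y)
        all {a} {b} ab with a <? 0ℚ
        ... | yes a<0 = moved ab a<0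
        ... | no a≮0  = b , core⊆g (∈-++⁺ʳ (diag C) (∈-filter⁺ nonneg? ab (≮⇒≥ a≮0))) , near-self (N-near ab)

    -- Both ends of a pair b < d refer to the same point between b and d, so
    -- Separated neighbourhoods of b and d lie on opposite sides of it.
    Separated : List ℚ → ℚ → Pred ℚ 0ℓ
    Separated ds b y = ∀ {d} → d ∈ ds →
      (∀ (b<d : b < d) → y < proj₁ (<-dense b<d)) × (∀ (d<b : d < b) → proj₁ (<-dense d<b) < y)

    near-separated : ∀ ds b → Near b (Separated ds b)
    near-separated ds b = near-⋂ ds λ {d} _ → near-× (left d) (right d)
      where
      left : ∀ d → Near b (λ y → ∀ (b<d : b < d) → y < proj₁ (<-dense b<d))
      left d with b <? d
      ... | no b≮d  = near-all (λ _ b<d → ⊥-elim (b≮d b<d))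
      ... | yes b<d = near-map (λ {y} u b<d′ → subst (λ e → y < proj₁ (<-dense e)) (<-irrelevant b<d b<d′) u)
                               (near-< (proj₁ (proj₂ (<-dense b<d))))
      right : ∀ d → Near b (λ y → ∀ (d<b : d < b) → proj₁ (<-dense d<b) < y)
      right d with d <? b
      ... | no d≮b  = near-all (λ _ d<b → ⊥-elim (d≮b d<b))
      ... | yes d<b = near-map (λ {y} u d<b′ → subst (λ e → proj₁ (<-dense e) < y) (<-irrelevant d<b d<b′) u)
                               (near-> (proj₂ (proj₂ (<-dense d<b))))

    -- Points are moved by value, not by index: if several coordinates of `w` equal `b`, its new
    -- position must fit all their intervals.
    InBox : ∀ {n} → Vec ℚ n → Vec Interval n → ℚ → Pred ℚ 0ℓ
    InBox w B b y = ∀ i → lookup w i ≡ b → y ∈ᴵ lookup B i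

    near-inBox : ∀ {n} {w : Vec ℚ n} {B} → w ∈ᴮ B → ∀ b → Near b (InBox w B b)
    near-inBox {n} {w} {B} w∈B b =
      near-map (λ h i → h (∈-allFin i)) (near-⋂ (allFin n) (λ {i} _ → coordinate i))
      where
      coordinate : ∀ i → Near b (λ y → lookup w i ≡ b → y ∈ᴵ lookup B i)
      coordinate i with lookup w i ≟ b
      ... | yes refl = near-map (λ y∈ _ → y∈) (near-interval (lookup B i) (Pointwise.lookup w∈B i))
      ... | no  wᵢ≢b = near-all (λ _ wᵢ≡b → ⊥-elim (wᵢ≢b wᵢ≡b))

    match-tabulate : ∀ {n p} {v : Vec ℚ n} {f : Fin n → ℚ} →
                     (∀ i → (lookup v i , f i) ∈ p) → Match p v (tabulate f)
    match-tabulate {v = []}    h = []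
    match-tabulate {v = _ ∷ _} h = h zero ∷ match-tabulate (h ∘ suc)

    tabulate-∈ᴮ : ∀ {n} {B : Vec Interval n} {f : Fin n → ℚ} →
                  (∀ i → f i ∈ᴵ lookup B i) → tabulate f ∈ᴮ B
    tabulate-∈ᴮ {B = []}    h = []
    tabulate-∈ᴮ {B = _ ∷ _} h = h zero ∷ tabulate-∈ᴮ (h ∘ suc)

    perturb-box : ∀ {C p n} {v w : Vec ℚ n} {B} → Closed C → diag C ⊆ p → Iso p → Match p v w → w ∈ᴮ B →
                  ∃[ g ] ∃[ w′ ] (Good g × diag C ⊆ g × Match g v w′ × w′ ∈ᴮ B)
    perturb-box {C} {p} {n} {v} {w} {B} cl C⊆p i m w∈B =
      let g , good , C⊆g , moved = perturb
          coordinate = λ j → moved (Pointwise.lookup m j)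
      in  g , tabulate (λ j → proj₁ (coordinate j)) , good , C⊆g ,
          match-tabulate (λ j → proj₁ (proj₂ (coordinate j))) ,
          tabulate-∈ᴮ (λ j → proj₂ (proj₂ (proj₂ (coordinate j))) j refl)
      where
      ds = map proj₂ p
      open Perturb cl C⊆p i (λ b y → Separated ds b y × InBox w B b y)
        (λ _ → near-× (near-separated ds _) (near-inBox w∈B _))
        (λ ab cd b<d (y-sep , _) (z-sep , _) →
          <-trans (proj₁ (y-sep (∈-map⁺ proj₂ cd)) b<d) (proj₂ (z-sep (∈-map⁺ proj₂ ab)) b<d))

    match-diag : ∀ {C p n} (c : Vec ℚ n) → diag C ⊆ p → (∀ {x} → x ∈ toList c → x ∈ C) → Match p c c
    match-diag []      s h = []
    match-diag (x ∷ c) s h = s (∈-map⁺ _ (h (here refl))) ∷ match-diag c s (h ∘ there)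

    -- Supports of open definable sets

    colours : ℚ → List ℚ
    colours x with x <? 0ℚ
    ... | yes x<0 = map proj₁ (ρ (x , x<0))
    ... | no  _   = []

    A⇒∈colours : ∀ {x u} → A[ ρ ] x u → u ∈ colours x
    A⇒∈colours {x} a with x <? 0ℚ
    ... | yes x<0 = ∈-map⁺ proj₁ (proj₂ (A-member x<0 a))
    ... | no x≮0  = ⊥-elim (x≮0 (proj₁ a))

    colours>0 : ∀ {x u} → u ∈ colours x → 0ℚ < u
    colours>0 {x} h with x <? 0ℚ
    ... | yes x<0 with ∈-map⁻ proj₁ h
    ...   | (_ , 0<u) , _ , refl = 0<u

    -- One round of adding codes is enough: codes consist of positive points, and these have no
    -- code.
    closure : List ℚ → List ℚ
    closure c = 0ℚ ∷ c ++ concatMap colours c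

    closure-closed : ∀ c → Closed (closure c)
    closure-closed c = record { zero∈ = here refl ; A∈ = closed }
      where
      closed : ∀ {x u} → x ∈ closure c → A[ ρ ] x u → u ∈ closure c
      closed (here refl) (0<0 , _) = ⊥-elim (<-irrefl refl 0<0)
      closed (there h) a with ∈-++⁻ c h
      ... | inj₁ x∈c = there (∈-++⁺ʳ c (∈-concatMap⁺ colours (lose x∈c (A⇒∈colours a))))
      ... | inj₂ x∈  with find (∈-concatMap⁻ colours {xs = c} x∈)
      ...   | y , _ , k = ⊥-elim (<-asym (colours>0 {y} k) (proj₁ a))

    -- Only `w` is moved, inside a box provided by openness. The good map from `v` to the moved
    -- point fixes the parameters, so its inverse carries `φ` back to `v`.
    open-invariant : ∀ {n C k} {U : Pred (Vec ℚ n) 0ℓ} (φ : Formula 𝓛 _) (c : Vec ℚ k) → Open U →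
      (∀ v → U v ⇔ Sat (𝓠 ρ) φ (v Vec.++ c)) → Closed C → (∀ {x} → x ∈ toList c → x ∈ C) →
      ∀ {p v w} → Iso p → diag C ⊆ p → Match p v w → U w → U v
    open-invariant φ c U-open defines cl c⊆C {v = v} {w} i C⊆p m w∈U =
      let B , w∈B , B⊆U = U-open w w∈U
          g , w′ , good , C⊆g , m′ , w′∈B = perturb-box cl C⊆p i m w∈B
      in  from (defines v)
            (𝓠-transfer φ (good-swap good)
              (match-swap (Pointwise.++⁺ m′ (match-diag c C⊆g c⊆C)))
              (to (defines w′) (B⊆U w′∈B)))

    open-support : ∀ {n} (U : Pred (Vec ℚ n) 0ℓ) → Open U → Definable (𝓠 ρ) U →
      ∃[ C ] (∀ {p v w} → Iso p → diag C ⊆ p → Match p v w → U w → U v)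
    open-support U U-open (k , φ , c , defines) =
      closure (toList c) ,
      open-invariant φ c U-open defines (closure-closed (toList c)) (there ∘ ∈-++⁺ˡ)


    -- The open core

    diag-swap : ∀ {C p} → diag C ⊆ p → diag C ⊆ map swap p
    diag-swap C⊆p h with ∈-map⁻ _ h
    ... | _ , _ , refl = ∈-swap (C⊆p h)

    support : Σ ℕ (Language.RelSym (openCoreLanguage (𝓠 ρ))) → List ℚ
    support (_ , U , U-open , U-def) = proj₁ (open-support U U-open U-def)

    supports : ∀ {n} → Formula (openCoreLanguage (𝓠 ρ)) n → List ℚ
    supports φ = concatMap support (rels φ)

    -- A back-and-forth with order isomorphisms alone: density of the order extends them, and each
    -- open set named in `φ` is preserved because its support is fixed.
    open-core-transfer : ∀ {n} (φ : Formula (openCoreLanguage (𝓠 ρ)) n) {p v w} →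
      Iso p → diag (supports φ) ⊆ p → Match p v w →
      Sat (openCore (𝓠 ρ)) φ v → Sat (openCore (𝓠 ρ)) φ w
    open-core-transfer φ i C⊆p m = BF.transfer (λ ()) φ pres-rel (i , C⊆p) m
      where
      Sys : Pred (Pairs ℚ) 0ℓ
      Sys p = Iso p × diag (supports φ) ⊆ p
      sys-forth : ∀ {p} → Sys p → ∀ x → ∃[ y ] ∃[ q ] (Sys q × p ⊆ q × (x , y) ∈ q)
      sys-forth (i , C⊆p) x =
        let y , q , i′ , p⊆q , xy = iso-forth i x in y , q , (i′ , p⊆q ∘ C⊆p) , p⊆q , xy
      module BF = BackAndForth (openCore (𝓠 ρ)) Sys
        (λ (i , C⊆p) → iso-swap i , diag-swap C⊆p) (λ (i , _) → func i) sys-forth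
      pres-rel : ∀ {k P} → (k , P) ∈ rels φ → BF.PreservesRel P
      pres-rel {k} {P@(U , U-open , U-def)} P∈φ (i , C⊆p) m =
        -- Supports pull membership back along a map, so pushing it forward uses the inverse.
        proj₂ (open-support U U-open U-def) (iso-swap i)
          (diag-swap (C⊆p ∘ map⁺ _ (λ c∈ → ∈-concatMap⁺ support (lose P∈φ c∈))))
          (match-swap m)

    -- O-minimality

    diag-iso : ∀ C → Iso (diag C)
    diag-iso C = record { mono = mono′ ; mono⁻ = mono⁻′ }
      where
      mono′ : ∀ {a b c d} → (a , b) ∈ diag C → (c , d) ∈ diag C → a < c → b < d
      mono′ h k u with ∈-map⁻ _ h | ∈-map⁻ _ k
      ... | _ , _ , refl | _ , _ , refl = u
      mono⁻′ : ∀ {a b c d} → (a , b) ∈ diag C → (c , d) ∈ diag C → b < d → a < c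
      mono⁻′ h k u with ∈-map⁻ _ h | ∈-map⁻ _ k
      ... | _ , _ , refl | _ , _ , refl = u

    -- If `x` is in `C` then `y` equals it and the identity on `C` already works; otherwise the pair
    -- is new and `Same` supplies the conditions of `iso-∷`.
    same-iso : ∀ {C x y} → Same C x y → ∃[ p ] (Iso p × diag C ⊆ p × (x , y) ∈ p)
    same-iso {C} {x} {y} same with em {x ∈ C}
    ... | no x∉C = (x , y) ∷ diag C , iso-∷ (diag-iso C) side , there , here refl
      where
      side : ∀ {a b} → (a , b) ∈ diag C → SameSide x y a b
      side h with ∈-map⁻ _ h
      ... | _ , c∈C , refl = proj₁ (same c∈C) , proj₁ (proj₂ (same c∈C)) , λ { refl → x∉C c∈C }
    ... | yes x∈C with proj₂ (proj₂ (same x∈C)) refl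
    ...   | refl = diag C , diag-iso C , id , ∈-map⁺ _ x∈C

    open-core-o-minimal : OMinimal (openCore (𝓠 ρ))
    open-core-o-minimal S (k , φ , c , defines) = finite-union S C invariant
      where
      -- Fixing these points fixes the parameters and the support of every symbol of `φ`.
      C = supports φ ++ toList c
      invariant : ∀ {x y} → Same C x y → S x → S y
      invariant {x} {y} same x∈S =
        let p , i , C⊆p , xy = same-iso same
        in  from (defines (y ∷ []))
              (open-core-transfer φ i (C⊆p ∘ map⁺ _ ∈-++⁺ˡ)
                (xy ∷ match-diag c C⊆p (∈-++⁺ʳ (supports φ)))
                (to (defines (x ∷ [])) x∈S))

theorem4p6 : ExcludedMiddle 0ℓ →
    (ρ : ℚ⁻ → 𝓕) →
    (∀ (F : 𝓕) → Ordered.Dense _<⁻_ (Fiber ρ F) × Ordered.Codense _<⁻_ (Fiber ρ F)) →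
    Ordered.OMinimal _<_ (Ordered.openCore _<_ (𝓠 ρ))
theorem4p6 em ρ dense-codense = open-core-o-minimal em ρ (proj₁ ∘ dense-codense)
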